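{- Let $A=(a_{ij})$, $B=(b_{ij})$ and $X=(x_{ij})$, $i,j=0,1,2,3,\dots$, be the infinite matrices with entries in $\mathbb{Z}[[q]]$ defined by $$a_{ij}=q^{(4i+1)(4j+1)}\quad (i,j\ge 0),$$ $$b_{ij}=\begin{cases}-q^{(4i-1)(4j-1)} & \text{if } i,j>0,\\ \sum_{n=0}^{\infty}q^{(2n+1)^2} & \text{if } i=j=0,\\ 0 & \text{otherwise,}\end{cases}$$ $$x_{ij}=\begin{cases}-\dfrac{q^{12(j-i-1)+4}}{1-q^{16(j-i-1)+8}} & \text{if } j>i,\\[2mm] \dfrac{q^{4(i-j)}}{1-q^{16(i-j)+8}} & \text{if } 1\le j\le i,\\[2mm] \dfrac{(q^8;q^{16})_i}{(q^{16};q^{16})_i}\,q^{4i} & \text{if } j=0.\end{cases}$$ Then $XB=AX$.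
   Context: Notation: $(a;q)_0=1$ and $(a;q)_n=(1-a)(1-aq)\cdots(1-aq^{n-1})$ for $n\ge1$; thus $(q^8;q^{16})_i=\prod_{m=0}^{i-1}(1-q^{8+16m})$ and $(q^{16};q^{16})_i=\prod_{m=1}^{i}(1-q^{16m})$. All matrices are infinite, indexed by $i,j\in\{0,1,2,\dots\}$, with entries formal power series in $q$, fractions being expanded as power series in $q$. Matrix products are given by $(MN)_{ij}=\sum_{m\ge 0}M_{im}N_{mj}$; for $XB$ and $AX$ these infinite sums converge in the $q$-adic topology on $\mathbb{Z}[[q]]$ (that is, for each exponent of $q$ only finitely many terms contribute). -}

module Defs where

open import Data.Bool.Base using (if_then_else_)
open import Data.Fin.Base using (toℕ)
open import Data.Integer.Base as ℤ using (ℤ; 0ℤ; 1ℤ)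
open import Data.Integer.Properties using (+-*-semiring)
open import Data.Nat.Base
  using (ℕ; zero; suc; _+_; _*_; _∸_; _^_; _≤_; _<_; z≤n; s≤s; _≡ᵇ_; _<ᵇ_)
open import Data.Product.Base using (∃; _,_)
open import Relation.Binary.PropositionalEquality using (_≡_; refl; cong; cong₂)

open import Algebra.Properties.Semiring.Sum +-*-semiring using (sum)

∑< : ℕ → (ℕ → ℤ) → ℤ
∑< n f = sum {n} (λ i → f (toℕ i))

-- ℤ[[q]]: a power series is its sequence of coefficients.

ℤ⟦q⟧ : Set
ℤ⟦q⟧ = ℕ → ℤ

infixl 6 _⊖_
infixl 7 _⊛_ _⊘_
infixr 8 _⊛^_
infix  8 ⊖_
infix  9 q^_

𝟎 : ℤ⟦q⟧
𝟎 _ = 0ℤ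

q^_ : ℕ → ℤ⟦q⟧
(q^ k) n = if k ≡ᵇ n then 1ℤ else 0ℤ

𝟏 : ℤ⟦q⟧
𝟏 = q^ 0

⊖_ : ℤ⟦q⟧ → ℤ⟦q⟧
(⊖ f) n = ℤ.- f n

_⊖_ : ℤ⟦q⟧ → ℤ⟦q⟧ → ℤ⟦q⟧
(f ⊖ g) n = f n ℤ.- g n

_⊛_ : ℤ⟦q⟧ → ℤ⟦q⟧ → ℤ⟦q⟧
(f ⊛ g) n = ∑< (suc n) (λ k → f k ℤ.* g (n ∸ k))

_⊛^_ : ℤ⟦q⟧ → ℕ → ℤ⟦q⟧
f ⊛^ zero  = 𝟏
f ⊛^ suc m = f ⊛ (f ⊛^ m)

-- Convergence of Σ_{m≥0} f m to s in the q-adic topology: every coefficient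
-- of the partial sums is eventually equal to that of s.

_SumsTo_ : (ℕ → ℤ⟦q⟧) → ℤ⟦q⟧ → Set
f SumsTo s = ∀ n → ∃ λ N → ∀ M → N ≤ M → ∑< M (λ m → f m n) ≡ s n

-- The infinite sum Σ_{m≥0} f m, meaningful for families in which f m is
-- divisible by q^m, so that only f 0, …, f n contribute to the coefficient
-- of q^n (see Σ∞-sumsTo).

Σ∞ : (ℕ → ℤ⟦q⟧) → ℤ⟦q⟧
Σ∞ f n = ∑< (suc n) (λ m → f m n)

∑<-truncate : ∀ {n M} (g : ℕ → ℤ) → (∀ m → n ≤ m → g m ≡ 0ℤ) → n ≤ M →
              ∑< M g ≡ ∑< n g
∑<-truncate {M = zero}  g g≡0 z≤n       = refl
∑<-truncate {M = suc M} g g≡0 z≤n       =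
  cong₂ ℤ._+_ (g≡0 0 z≤n) (∑<-truncate {M = M} (λ m → g (suc m)) (λ m _ → g≡0 (suc m) z≤n) z≤n)
∑<-truncate             g g≡0 (s≤s n≤M) =
  cong (ℤ._+_ (g 0)) (∑<-truncate (λ m → g (suc m)) (λ m n≤m → g≡0 (suc m) (s≤s n≤m)) n≤M)

Σ∞-sumsTo : (f : ℕ → ℤ⟦q⟧) → (∀ m n → n < m → f m n ≡ 0ℤ) → f SumsTo Σ∞ f
Σ∞-sumsTo f f≡0 n = suc n , λ M n<M → ∑<-truncate (λ m → f m n) (λ m → f≡0 m n) n<M

-- f ⊘ g is the expansion of f / g for g with constant coefficient 1, via
-- 1 / g = Σ_{m≥0} (1 - g)^m.  Every denominator below has this form.

_⊘_ : ℤ⟦q⟧ → ℤ⟦q⟧ → ℤ⟦q⟧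
f ⊘ g = f ⊛ Σ∞ (λ m → (𝟏 ⊖ g) ⊛^ m)

-- qPoch a p n is (a; p)_n.

qPoch : ℤ⟦q⟧ → ℤ⟦q⟧ → ℕ → ℤ⟦q⟧
qPoch a p zero    = 𝟏
qPoch a p (suc n) = qPoch a p n ⊛ (𝟏 ⊖ a ⊛ (p ⊛^ n))

Matrix : Set
Matrix = ℕ → ℕ → ℤ⟦q⟧

-- L · R ⇒ P: all the infinite sums Σ_m L i m R m j converge, and P is the
-- matrix of their values.

_·_⇒_ : Matrix → Matrix → Matrix → Set
L · R ⇒ P = ∀ i j → (λ m → L i m ⊛ R m j) SumsTo P i j

A : Matrix
A i j = q^ ((4 * i + 1) * (4 * j + 1))

B : Matrix
B zero      zero      = Σ∞ (λ n → q^ ((2 * n + 1) ^ 2))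
B i@(suc _) j@(suc _) = ⊖ q^ ((4 * i ∸ 1) * (4 * j ∸ 1))
B zero      (suc _)   = 𝟎
B (suc _)   zero      = 𝟎

X : Matrix
X i zero      = (qPoch (q^ 8) (q^ 16) i ⊘ qPoch (q^ 16) (q^ 16) i) ⊛ q^ (4 * i)
X i j@(suc _) =
  if i <ᵇ j
  then ⊖ (q^ (12 * (j ∸ i ∸ 1) + 4) ⊘ (𝟏 ⊖ q^ (16 * (j ∸ i ∸ 1) + 8)))
  else (q^ (4 * (i ∸ j)) ⊘ (𝟏 ⊖ q^ (16 * (i ∸ j) + 8)))

module Submission where

open import Defs
open import Data.Product.Base using (∃; _×_)

open import Algebra.Bundles using (CommutativeRing)
import Algebra.Solver.Ring
open import Algebra.Solver.Ring.AlmostCommutativeRing using (fromCommutativeRing; _-Raw-AlmostCommutative⟶_)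
open import Data.Bool.Base using (if_then_else_; true; false)
open import Data.Fin.Base using (toℕ)
open import Data.Integer.Base as ℤ using (ℤ; 0ℤ; 1ℤ)
import Data.Integer.Properties as ℤₚ
open import Data.Integer.Tactic.RingSolver using (solve-∀)
open import Data.Nat.Base
  using (ℕ; zero; suc; _+_; _*_; _∸_; _^_; _⊔_; _≤_; _<_; z≤n; s≤s; z<s; s<s; _≡ᵇ_; _<ᵇ_)
import Data.Nat.Properties as ℕₚ
import Data.Nat.Tactic.RingSolver as ℕ-RingSolver
open import Data.Product.Base using (_,_; proj₁; proj₂)
open import Data.Vec.Base as Vec using (allFin)
open import Data.Vec.N-ary using (N-ary; _$ⁿ_; curryⁿ; curryⁿ-cong; Eq)
open import Function.Base using (_∘_)
open import Relation.Binary.Definitions using (WeaklyDecidable)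
open import Relation.Binary.PropositionalEquality
open import Relation.Nullary.Decidable using (map′; dec⇒maybe)

open import Algebra.Properties.Semiring.Sum ℤₚ.+-*-semiring
  using (sum-cong-≗; ∑-distrib-+; ∑-comm; *-distribˡ-sum)

-- Column 0.  With t = q⁸ and u_m = (t;t²)_m/(t²;t²)_m, the entry (AX)_{i0} is
-- q^{4i+1} F(t^{2i+1}) for F(z) = Σ_m u_m z^m.  Telescoping gives
-- (1 − z) F(z) = (1 − tz) F(t²z), hence F(t^{2i+1}) = u_i F(t), and it remains
-- to prove Gauss's identity F(t) = Σ_k t^{k(k+1)/2}.  The tails
-- S_n = Σ_m u_{m+n} x^m at x = t^{2n+1} satisfy
-- (1 − x) S_n = u_n (1 − x²) + t x² (1 − tx) S_{n+1}  (a case of the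
-- Rogers–Fine iteration), and each such step splits off two terms of the sum.
--
-- Column j + 1.  Let b_s = 16s + 8 and c = 16ij + 12i + 4j + 5.  Every term of
-- both products is ± q^a / (1 − q^{b_s}); subtracting a finite geometric
-- progression moves each exponent a to c + 8s.  For the terms with
-- negative sign the progressions form the same double sum in XB and in AX,
-- summed in the two orders.  For the others, summing first over s turns
-- Σ_s q^{c + 8s + k b_s} into q^{c + 8k} / (1 − q^{b_k}).  Both sides become
-- Σ_s q^{c + 8s}/(1 − q^{b_s}) minus the terms s < i, the terms s ≤ j and the
-- double sum.

-- The commutative ring of formal power series.

infix  4 _≈_
infixl 6 _⊕_

private
  variable
    f g h : ℤ⟦q⟧
    F G : ℕ → ℤ⟦q⟧

-- A record, so that `f` and `g` can be inferred from a proof; propositional equality of coefficient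
-- functions would need function extensionality.
record _≈_ (f g : ℤ⟦q⟧) : Set where
  constructor pointwise
  field coeff : ∀ n → f n ≡ g n

open _≈_

_⊕_ : ℤ⟦q⟧ → ℤ⟦q⟧ → ℤ⟦q⟧
(f ⊕ g) n = f n ℤ.+ g n

-- Definitionally, (f ⊛ g) (suc n) = f 0 * g (suc n) + (tail f ⊛ g) n.
tail : ℤ⟦q⟧ → ℤ⟦q⟧
tail f n = f (suc n)

∑<-cong : ∀ M {f g : ℕ → ℤ} → (∀ m → f m ≡ g m) → ∑< M f ≡ ∑< M g
∑<-cong M f≡g = sum-cong-≗ {M} (f≡g ∘ toℕ)

∑<-+ : ∀ M (f g : ℕ → ℤ) → ∑< M (λ m → f m ℤ.+ g m) ≡ ∑< M f ℤ.+ ∑< M g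
∑<-+ M f g = ∑-distrib-+ {M} (f ∘ toℕ) (g ∘ toℕ)

⊛-cong-coeff : ∀ n → (∀ k → k ≤ n → f k ≡ g k) → (h ⊛ f) n ≡ (h ⊛ g) n
⊛-cong-coeff {h = h} zero    f≡g = cong (λ a → h 0 ℤ.* a ℤ.+ 0ℤ) (f≡g 0 z≤n)
⊛-cong-coeff {h = h} (suc n) f≡g = cong₂ (λ a b → h 0 ℤ.* a ℤ.+ b) (f≡g (suc n) ℕₚ.≤-refl)
  (⊛-cong-coeff {h = tail h} n (λ k k≤n → f≡g k (ℕₚ.m≤n⇒m≤1+n k≤n)))

-- `⊛` peels off its first summand by definition; peeling off the last one is the mirror image that
-- closes the induction for commutativity.
⊛-last : ∀ f g n → (f ⊛ g) (suc n) ≡ (f ⊛ tail g) n ℤ.+ f (suc n) ℤ.* g 0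
⊛-last f g zero    = rearrange (f 0 ℤ.* g 1) (f 1 ℤ.* g 0)
  where
  rearrange : ∀ a b → a ℤ.+ (b ℤ.+ 0ℤ) ≡ a ℤ.+ 0ℤ ℤ.+ b
  rearrange = solve-∀
⊛-last f g (suc n) = trans
  (cong (λ a → f 0 ℤ.* g (2 + n) ℤ.+ a) (⊛-last (tail f) g n))
  (sym (ℤₚ.+-assoc (f 0 ℤ.* g (2 + n)) _ _))

⊛-comm-coeff : ∀ f g n → (f ⊛ g) n ≡ (g ⊛ f) n
⊛-comm-coeff f g zero    = cong (ℤ._+ 0ℤ) (ℤₚ.*-comm (f 0) (g 0))
⊛-comm-coeff f g (suc n) = begin
  f 0 ℤ.* g (suc n) ℤ.+ (tail f ⊛ g) n ≡⟨ cong₂ ℤ._+_ (ℤₚ.*-comm (f 0) _) (⊛-comm-coeff (tail f) g n) ⟩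
  g (suc n) ℤ.* f 0 ℤ.+ (g ⊛ tail f) n ≡⟨ ℤₚ.+-comm (g (suc n) ℤ.* f 0) _ ⟩
  (g ⊛ tail f) n ℤ.+ g (suc n) ℤ.* f 0 ≡⟨ ⊛-last g f n ⟨
  (g ⊛ f) (suc n) ∎
  where open ≡-Reasoning

⊛-distribˡ-coeff : ∀ f g h n → (f ⊛ (g ⊕ h)) n ≡ (f ⊛ g ⊕ f ⊛ h) n
⊛-distribˡ-coeff f g h n = trans
  (∑<-cong (suc n) (λ k → ℤₚ.*-distribˡ-+ (f k) (g (n ∸ k)) (h (n ∸ k))))
  (∑<-+ (suc n) (λ k → f k ℤ.* g (n ∸ k)) (λ k → f k ℤ.* h (n ∸ k)))

⊛-zeroˡ-coeff : ∀ f n → (𝟎 ⊛ f) n ≡ 0ℤ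
⊛-zeroˡ-coeff f zero    = refl
⊛-zeroˡ-coeff f (suc n) = cong (λ a → 0ℤ ℤ.+ a) (⊛-zeroˡ-coeff f n)

⊛-identityˡ-coeff : ∀ f n → (𝟏 ⊛ f) n ≡ f n
⊛-identityˡ-coeff f zero    = trans (ℤₚ.+-identityʳ _) (ℤₚ.*-identityˡ (f 0))
⊛-identityˡ-coeff f (suc n) = trans
  (cong₂ ℤ._+_ (ℤₚ.*-identityˡ (f (suc n))) (⊛-zeroˡ-coeff f n))
  (ℤₚ.+-identityʳ _)

-- Induction through `tail (f ⊛ g)`, which is `f 0` times `tail g` plus `tail f ⊛ g`.
⊛-assoc-coeff : ∀ f g h n → ((f ⊛ g) ⊛ h) n ≡ (f ⊛ (g ⊛ h)) n
⊛-assoc-coeff f g h zero    = rearrange (f 0) (g 0) (h 0)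
  where
  rearrange : ∀ a b c → (a ℤ.* b ℤ.+ 0ℤ) ℤ.* c ℤ.+ 0ℤ ≡ a ℤ.* (b ℤ.* c ℤ.+ 0ℤ) ℤ.+ 0ℤ
  rearrange = solve-∀
⊛-assoc-coeff f g h (suc n) = begin
  (f 0 ℤ.* g 0 ℤ.+ 0ℤ) ℤ.* h (suc n) ℤ.+ ((a·tail-g ⊕ tail f ⊛ g) ⊛ h) n
    ≡⟨ cong (λ u → (f 0 ℤ.* g 0 ℤ.+ 0ℤ) ℤ.* h (suc n) ℤ.+ u) (distribʳ a·tail-g (tail f ⊛ g)) ⟩
  (f 0 ℤ.* g 0 ℤ.+ 0ℤ) ℤ.* h (suc n) ℤ.+ ((a·tail-g ⊛ h) n ℤ.+ ((tail f ⊛ g) ⊛ h) n)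
    ≡⟨ cong₂ (λ u v → (f 0 ℤ.* g 0 ℤ.+ 0ℤ) ℤ.* h (suc n) ℤ.+ (u ℤ.+ v)) scale (⊛-assoc-coeff (tail f) g h n) ⟩
  (f 0 ℤ.* g 0 ℤ.+ 0ℤ) ℤ.* h (suc n) ℤ.+ (f 0 ℤ.* (tail g ⊛ h) n ℤ.+ (tail f ⊛ (g ⊛ h)) n)
    ≡⟨ rearrange (f 0) (g 0) (h (suc n)) _ _ ⟩
  (f ⊛ (g ⊛ h)) (suc n) ∎
  where
  open ≡-Reasoning
  a·tail-g : ℤ⟦q⟧
  a·tail-g n = f 0 ℤ.* tail g n
  distribʳ : ∀ u v → ((u ⊕ v) ⊛ h) n ≡ (u ⊛ h) n ℤ.+ (v ⊛ h) n
  distribʳ u v = trans (⊛-comm-coeff (u ⊕ v) h n) (trans (⊛-distribˡ-coeff h u v n)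
    (cong₂ ℤ._+_ (⊛-comm-coeff h u n) (⊛-comm-coeff h v n)))
  scale : (a·tail-g ⊛ h) n ≡ f 0 ℤ.* (tail g ⊛ h) n
  scale = trans (∑<-cong (suc n) (λ k → ℤₚ.*-assoc (f 0) (tail g k) (h (n ∸ k))))
    (sym (*-distribˡ-sum {suc n} (f 0) (λ k → tail g (toℕ k) ℤ.* h (n ∸ toℕ k))))
  rearrange : ∀ a b c u v → (a ℤ.* b ℤ.+ 0ℤ) ℤ.* c ℤ.+ (a ℤ.* u ℤ.+ v) ≡ a ℤ.* (b ℤ.* c ℤ.+ u) ℤ.+ v
  rearrange = solve-∀

⊛-comm : ∀ f g → f ⊛ g ≈ g ⊛ f
⊛-comm f g = pointwise (⊛-comm-coeff f g)

ℤ⟦q⟧-commutativeRing : CommutativeRing _ _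
ℤ⟦q⟧-commutativeRing = record
  { Carrier = ℤ⟦q⟧ ; _≈_ = _≈_ ; _+_ = _⊕_ ; _*_ = _⊛_ ; -_ = ⊖_ ; 0# = 𝟎 ; 1# = 𝟏
  ; isCommutativeRing = record
    { isRing = record
      { +-isAbelianGroup = record
        { isGroup = record
          { isMonoid = record
            { isSemigroup = record
              { isMagma = record
                { isEquivalence = ≈-isEquivalence
                ; ∙-cong = λ p q → pointwise λ n → cong₂ ℤ._+_ (coeff p n) (coeff q n) }
              ; assoc = λ f g h → pointwise λ n → ℤₚ.+-assoc (f n) (g n) (h n) }
            ; identity = (λ f → pointwise (ℤₚ.+-identityˡ ∘ f)) , (λ f → pointwise (ℤₚ.+-identityʳ ∘ f)) }
          ; inverse = (λ f → pointwise (ℤₚ.+-inverseˡ ∘ f)) , (λ f → pointwise (ℤₚ.+-inverseʳ ∘ f))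
          ; ⁻¹-cong = λ p → pointwise λ n → cong ℤ.-_ (coeff p n) }
        ; comm = λ f g → pointwise λ n → ℤₚ.+-comm (f n) (g n) }
      ; *-cong = ⊛-cong
      ; *-assoc = λ f g h → pointwise (⊛-assoc-coeff f g h)
      ; *-identity = identityˡ , λ f → ≈-trans (⊛-comm f 𝟏) (identityˡ f)
      ; distrib = distribˡ , λ f g h → ≈-trans (⊛-comm (g ⊕ h) f)
          (≈-trans (distribˡ f g h) (⊕-cong (⊛-comm f g) (⊛-comm f h))) }
    ; *-comm = ⊛-comm } }
  where
  open import Relation.Binary.Structures using (IsEquivalence)
  ≈-trans : f ≈ g → g ≈ h → f ≈ h
  ≈-trans p q = pointwise λ n → trans (coeff p n) (coeff q n)
  ≈-isEquivalence : IsEquivalence _≈_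
  ≈-isEquivalence = record
    { refl = pointwise λ n → refl ; sym = λ p → pointwise λ n → sym (coeff p n) ; trans = ≈-trans }
  ⊕-cong : ∀ {f f′ g g′} → f ≈ f′ → g ≈ g′ → f ⊕ g ≈ f′ ⊕ g′
  ⊕-cong p q = pointwise λ n → cong₂ ℤ._+_ (coeff p n) (coeff q n)
  ⊛-cong : ∀ {f f′ g g′} → f ≈ f′ → g ≈ g′ → f ⊛ g ≈ f′ ⊛ g′
  ⊛-cong p q = pointwise λ n → ∑<-cong (suc n) λ k → cong₂ ℤ._*_ (coeff p k) (coeff q (n ∸ k))
  identityˡ : ∀ f → 𝟏 ⊛ f ≈ f
  identityˡ f = pointwise (⊛-identityˡ-coeff f)
  distribˡ : ∀ f g h → f ⊛ (g ⊕ h) ≈ f ⊛ g ⊕ f ⊛ h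
  distribˡ f g h = pointwise (⊛-distribˡ-coeff f g h)

-- The ring solver for power series.

module R = CommutativeRing ℤ⟦q⟧-commutativeRing

-- The solver's coefficients. The test `0 ≡ᵇ n` is the one in `q^ 0`, so `con 1ℤ` evaluates to `𝟏`
-- by definition.
constant : ℤ → ℤ⟦q⟧
constant a n = if 0 ≡ᵇ n then a else 0ℤ

constant-homomorphism : CommutativeRing.rawRing ℤₚ.+-*-commutativeRing
                        -Raw-AlmostCommutative⟶ fromCommutativeRing ℤ⟦q⟧-commutativeRing
constant-homomorphism = record
  { ⟦_⟧    = constant
  ; +-homo = λ a b → pointwise λ { zero → refl ; (suc n) → refl }
  ; *-homo = λ a b → pointwise λ { zero → sym (ℤₚ.+-identityʳ _) ; (suc n) → sym (*-homo-suc a b n) }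
  ; -‿homo = λ a → pointwise λ { zero → refl ; (suc n) → refl }
  ; 0-homo = pointwise λ { zero → refl ; (suc n) → refl }
  ; 1-homo = R.refl
  }
  where
  *-homo-suc : ∀ a b n → (constant a ⊛ constant b) (suc n) ≡ 0ℤ
  *-homo-suc a b n = cong₂ ℤ._+_ (ℤₚ.*-zeroʳ a) (⊛-zeroˡ-coeff (constant b) n)

constant-≟ : WeaklyDecidable (λ a b → constant a ≈ constant b)
constant-≟ a b = dec⇒maybe (map′ (λ { refl → R.refl }) (λ p → coeff p 0) (a ℤₚ.≟ b))

module RS = Algebra.Solver.Ring
  (CommutativeRing.rawRing ℤₚ.+-*-commutativeRing)
  (fromCommutativeRing ℤ⟦q⟧-commutativeRing)
  constant-homomorphism
  constant-≟

open RS using (Polynomial; ⟦_⟧; ⟦_⟧N; normalise; var; con; _:+_; _:*_; :-_; _:-_; _:=_)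

-- RS.solve compares the values of the two normal forms, which unfolds the
-- convolutions; comparing the normal forms themselves is fast.
solve : ∀ n (f : N-ary n (Polynomial n) (Polynomial n × Polynomial n)) →
        let (l , r) = f $ⁿ Vec.map var (allFin n) in
        normalise l ≡ normalise r → Eq n _≈_ (curryⁿ ⟦ l ⟧) (curryⁿ ⟦ r ⟧)
solve n f l≡r = let (l , r) = f $ⁿ Vec.map var (allFin n) in
  curryⁿ-cong _≈_ ⟦ l ⟧ ⟦ r ⟧ (λ ρ → RS.prove ρ l r (R.reflexive (cong (λ p → ⟦ p ⟧N ρ) l≡r)))

-- Finite and infinite sums of power series

∑<-cong-< : ∀ M {f g : ℕ → ℤ} → (∀ m → m < M → f m ≡ g m) → ∑< M f ≡ ∑< M g
∑<-cong-< zero    f≡g = refl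
∑<-cong-< (suc M) f≡g = cong₂ ℤ._+_ (f≡g 0 z<s) (∑<-cong-< M (λ m m<M → f≡g (suc m) (s<s m<M)))

∑<-zero : ∀ M → ∑< M (λ _ → 0ℤ) ≡ 0ℤ
∑<-zero zero    = refl
∑<-zero (suc M) = trans (ℤₚ.+-identityˡ _) (∑<-zero M)

∑<-split : ∀ K M (f : ℕ → ℤ) → ∑< (K + M) f ≡ ∑< K f ℤ.+ ∑< M (λ m → f (K + m))
∑<-split zero    M f = sym (ℤₚ.+-identityˡ _)
∑<-split (suc K) M f = trans (cong (λ a → f 0 ℤ.+ a) (∑<-split K M (f ∘ suc))) (sym (ℤₚ.+-assoc (f 0) _ _))

∑<-last : ∀ M (f : ℕ → ℤ) → ∑< (suc M) f ≡ ∑< M f ℤ.+ f M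
∑<-last zero    f = ℤₚ.+-comm (f 0) 0ℤ
∑<-last (suc M) f = trans (cong (λ a → f 0 ℤ.+ a) (∑<-last M (f ∘ suc))) (sym (ℤₚ.+-assoc (f 0) _ _))

∑<-reverse : ∀ M (f : ℕ → ℤ) → ∑< M (λ m → f (M ∸ suc m)) ≡ ∑< M f
∑<-reverse zero    f = refl
∑<-reverse (suc M) f = begin
  f M ℤ.+ ∑< M (λ m → f (M ∸ suc m)) ≡⟨ cong (λ a → f M ℤ.+ a) (∑<-reverse M f) ⟩
  f M ℤ.+ ∑< M f                     ≡⟨ ℤₚ.+-comm (f M) _ ⟩
  ∑< M f ℤ.+ f M                     ≡⟨ ∑<-last M f ⟨
  ∑< (suc M) f                       ∎
  where open ≡-Reasoning

⨁ : ℕ → (ℕ → ℤ⟦q⟧) → ℤ⟦q⟧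
⨁ M F n = ∑< M (λ m → F m n)

⨁-cong-< : ∀ M {F G : ℕ → ℤ⟦q⟧} → (∀ m → m < M → F m ≈ G m) → ⨁ M F ≈ ⨁ M G
⨁-cong-< M F≈G = pointwise λ n → ∑<-cong-< M (λ m m<M → coeff (F≈G m m<M) n)

⨁-cong : ∀ M {F G : ℕ → ℤ⟦q⟧} → (∀ m → F m ≈ G m) → ⨁ M F ≈ ⨁ M G
⨁-cong M F≈G = pointwise λ n → ∑<-cong M (λ m → coeff (F≈G m) n)

⨁-⊕ : ∀ M F G → ⨁ M (λ m → F m ⊕ G m) ≈ ⨁ M F ⊕ ⨁ M G
⨁-⊕ M F G = pointwise λ n → ∑<-+ M (λ m → F m n) (λ m → G m n)

⨁-⊖ : ∀ M F → ⨁ M (λ m → ⊖ F m) ≈ ⊖ ⨁ M F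
⨁-⊖ zero    F = pointwise λ n → refl
⨁-⊖ (suc M) F = R.trans (R.+-congˡ {⊖ F 0} (⨁-⊖ M (F ∘ suc)))
  (solve 2 (λ a b → (:- a) :+ (:- b) := :- (a :+ b)) refl (F 0) (⨁ M (F ∘ suc)))

⨁-⊛ : ∀ M g F → ⨁ M (λ m → g ⊛ F m) ≈ g ⊛ ⨁ M F
⨁-⊛ zero    g F = R.sym (R.zeroʳ g)
⨁-⊛ (suc M) g F = R.trans (R.+-congˡ {g ⊛ F 0} (⨁-⊛ M g (F ∘ suc))) (R.sym (R.distribˡ g (F 0) _))

⨁-last : ∀ M F → ⨁ (suc M) F ≈ ⨁ M F ⊕ F M
⨁-last M F = pointwise λ n → ∑<-last M (λ m → F m n)

⨁-reverse : ∀ M F → ⨁ M (λ m → F (M ∸ suc m)) ≈ ⨁ M F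
⨁-reverse M F = pointwise λ n → ∑<-reverse M (λ m → F m n)

⨁-swap : ∀ M N (F : ℕ → ℕ → ℤ⟦q⟧) → ⨁ M (λ m → ⨁ N (F m)) ≈ ⨁ N (λ k → ⨁ M (λ m → F m k))
⨁-swap M N F = pointwise λ n → ∑-comm {M} {N} (λ m k → F (toℕ m) (toℕ k) n)

-- Divisibility by q^k, the source both of convergence and of vanishing remainders.
record VanishesBelow (k : ℕ) (f : ℤ⟦q⟧) : Set where
  constructor vanishing
  field vanishes : ∀ n → n < k → f n ≡ 0ℤ

open VanishesBelow

vanishesBelow-≤ : ∀ {k l} → l ≤ k → VanishesBelow k f → VanishesBelow l f
vanishesBelow-≤ l≤k v = vanishing λ n n<l → vanishes v n (ℕₚ.<-≤-trans n<l l≤k)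

vanishesBelow-q^ : ∀ k → VanishesBelow k (q^ k)
vanishesBelow-q^ k = vanishing (below k)
  where
  below : ∀ k n → n < k → (q^ k) n ≡ 0ℤ
  below (suc k) zero    _         = refl
  below (suc k) (suc n) (s≤s n<k) = below k n n<k

vanishesBelow-⊛ʳ : ∀ {k} f → VanishesBelow k g → VanishesBelow k (f ⊛ g)
vanishesBelow-⊛ʳ {g = g} f v = vanishing λ n n<k → trans
  (⊛-cong-coeff {f = g} {g = 𝟎} {h = f} n (λ m m≤n → vanishes v m (ℕₚ.≤-<-trans m≤n n<k)))
  (coeff (R.zeroʳ f) n)

vanishesBelow-⊛ˡ : ∀ {k} g → VanishesBelow k f → VanishesBelow k (f ⊛ g)
vanishesBelow-⊛ˡ {f = f} g v = vanishing λ n n<k →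
  trans (coeff (⊛-comm f g) n) (vanishes (vanishesBelow-⊛ʳ g v) n n<k)

vanishesBelow-⊛^ : ∀ m → f 0 ≡ 0ℤ → VanishesBelow m (f ⊛^ m)
vanishesBelow-⊛^         zero    f0≡0 = vanishing λ _ ()
vanishesBelow-⊛^ {f = f} (suc m) f0≡0 = vanishing λ
  { zero    _         → cong (λ a → a ℤ.* (f ⊛^ m) 0 ℤ.+ 0ℤ) f0≡0
  ; (suc n) (s≤s n<m) → cong₂ (λ a b → a ℤ.* (f ⊛^ m) (suc n) ℤ.+ b) f0≡0
      (vanishes (vanishesBelow-⊛ʳ (tail f) (vanishesBelow-⊛^ m f0≡0)) n n<m) }

-- A record around _SumsTo_, so that both arguments can be inferred.
record _HasSum_ (F : ℕ → ℤ⟦q⟧) (f : ℤ⟦q⟧) : Set where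
  constructor hasSum
  field sumsTo : F SumsTo f

open _HasSum_

hasSum-cong : (∀ m → F m ≈ G m) → f ≈ g → F HasSum f → G HasSum g
hasSum-cong F≈G f≈g (hasSum F→f) = hasSum λ n → proj₁ (F→f n) , λ M N≤M → trans
  (∑<-cong M (λ m → sym (coeff (F≈G m) n)))
  (trans (proj₂ (F→f n) M N≤M) (coeff f≈g n))

-- Identities between infinite sums are proved below by exhibiting both sides as sums of one family.
hasSum-unique : F HasSum f → F HasSum g → f ≈ g
hasSum-unique (hasSum F→f) (hasSum F→g) = pointwise λ n →
  let N₁ , p₁ = F→f n
      N₂ , p₂ = F→g n
  in trans (sym (p₁ (N₁ ⊔ N₂) (ℕₚ.m≤m⊔n N₁ N₂))) (p₂ (N₁ ⊔ N₂) (ℕₚ.m≤n⊔m N₁ N₂))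

hasSum-𝟎 : (λ _ → 𝟎) HasSum 𝟎
hasSum-𝟎 = hasSum λ n → 0 , λ M _ → ∑<-zero M

hasSum-⊕ : F HasSum f → G HasSum g → (λ m → F m ⊕ G m) HasSum (f ⊕ g)
hasSum-⊕ {F = F} {G = G} (hasSum F→f) (hasSum G→g) = hasSum λ n →
  let N₁ , p₁ = F→f n
      N₂ , p₂ = G→g n
  in N₁ ⊔ N₂ , λ M N≤M → trans (∑<-+ M (λ m → F m n) (λ m → G m n))
       (cong₂ ℤ._+_ (p₁ M (ℕₚ.≤-trans (ℕₚ.m≤m⊔n N₁ N₂) N≤M)) (p₂ M (ℕₚ.≤-trans (ℕₚ.m≤n⊔m N₁ N₂) N≤M)))

hasSum-⊖ : F HasSum f → (λ m → ⊖ F m) HasSum (⊖ f)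
hasSum-⊖ {F = F} (hasSum F→f) = hasSum λ n →
  let N , p = F→f n in N , λ M N≤M → trans (coeff (⨁-⊖ M F) n) (cong ℤ.-_ (p M N≤M))

-- Coefficient `n` of the product involves finitely many coefficients of the partial sums; `partial`
-- takes the maximum of their thresholds.
hasSum-⊛ : ∀ g → F HasSum f → (λ m → g ⊛ F m) HasSum (g ⊛ f)
hasSum-⊛ {F = F} {f = f} g (hasSum F→f) = hasSum λ n →
  let N , p = partial g n in N , λ M N≤M → trans (coeff (⨁-⊛ M g F) n) (p M N≤M)
  where
  partial : ∀ g n → ∃ λ N → ∀ M → N ≤ M → (g ⊛ ⨁ M F) n ≡ (g ⊛ f) n
  partial g zero    = let N , p = F→f 0 in N , λ M N≤M → cong (λ a → g 0 ℤ.* a ℤ.+ 0ℤ) (p M N≤M)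
  partial g (suc n) =
    let N₁ , p₁ = F→f (suc n)
        N₂ , p₂ = partial (tail g) n
    in N₁ ⊔ N₂ , λ M N≤M → cong₂ (λ a b → g 0 ℤ.* a ℤ.+ b)
         (p₁ M (ℕₚ.≤-trans (ℕₚ.m≤m⊔n N₁ N₂) N≤M)) (p₂ M (ℕₚ.≤-trans (ℕₚ.m≤n⊔m N₁ N₂) N≤M))

hasSum-⨁ : ∀ K {F : ℕ → ℕ → ℤ⟦q⟧} {f : ℕ → ℤ⟦q⟧} → (∀ k → F k HasSum f k) →
           (λ m → ⨁ K (λ k → F k m)) HasSum ⨁ K f
hasSum-⨁ zero    F→f = hasSum-𝟎
hasSum-⨁ (suc K) F→f = hasSum-⊕ (F→f 0) (hasSum-⨁ K (F→f ∘ suc))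

hasSum-prefix : ∀ K → (λ m → F (K + m)) HasSum f → F HasSum (⨁ K F ⊕ f)
hasSum-prefix {F = F} {f = f} K (hasSum tail→f) = hasSum λ n →
  let N , p = tail→f n in K + N , λ M K+N≤M →
    let K≤M = ℕₚ.≤-trans (ℕₚ.m≤m+n K N) K+N≤M in begin
    ∑< M (λ m → F m n)                ≡⟨ cong (λ M → ∑< M (λ m → F m n)) (ℕₚ.m+[n∸m]≡n K≤M) ⟨
    ∑< (K + (M ∸ K)) (λ m → F m n)    ≡⟨ ∑<-split K (M ∸ K) (λ m → F m n) ⟩
    ⨁ K F n ℤ.+ ∑< (M ∸ K) (λ m → F (K + m) n)
      ≡⟨ cong (λ a → ⨁ K F n ℤ.+ a) (p (M ∸ K)
           (subst (_≤ M ∸ K) (ℕₚ.m+n∸m≡n K N) (ℕₚ.∸-monoˡ-≤ K K+N≤M))) ⟩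
    ⨁ K F n ℤ.+ f n                   ∎
  where open ≡-Reasoning

-- The partial sums are `T 0 ⊖ T M`, and `T M` tends to zero q-adically.
hasSum-telescope : ∀ (T : ℕ → ℤ⟦q⟧) → (∀ m → VanishesBelow m (T m)) →
                   (∀ m → F m ≈ T m ⊖ T (suc m)) → F HasSum T 0
hasSum-telescope {F = F} T T-v F≈ΔT = hasSum λ n → suc n , λ M n<M → begin
  ∑< M (λ m → F m n) ≡⟨ coeff (partial M) n ⟩
  T 0 n ℤ.- T M n    ≡⟨ cong (λ a → T 0 n ℤ.- a) (vanishes (T-v M) n n<M) ⟩
  T 0 n ℤ.+ 0ℤ       ≡⟨ ℤₚ.+-identityʳ (T 0 n) ⟩
  T 0 n              ∎
  where
  open ≡-Reasoning
  partial : ∀ M → ⨁ M F ≈ T 0 ⊖ T M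
  partial zero    = R.sym (R.-‿inverseʳ (T 0))
  partial (suc M) = R.trans (⨁-last M F) (R.trans (R.+-cong (partial M) (F≈ΔT M))
    (solve 3 (λ a b c → (a :- b) :+ (b :- c) := a :- c) refl (T 0) (T M) (T (suc M))))

Σ∞-hasSum : (∀ m → VanishesBelow m (F m)) → F HasSum Σ∞ F
Σ∞-hasSum {F} v = hasSum (Σ∞-sumsTo F (λ m → vanishes (v m)))

-- Division and powers

⊛-congˡ : ∀ f → g ≈ h → f ⊛ g ≈ f ⊛ h
⊛-congˡ f = R.*-congˡ {f}

⊛-congʳ : ∀ f → g ≈ h → g ⊛ f ≈ h ⊛ f
⊛-congʳ f = R.*-congʳ {f}

recip : ℤ⟦q⟧ → ℤ⟦q⟧
recip g = Σ∞ (λ m → (𝟏 ⊖ g) ⊛^ m)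

-- With p_m = (1 - g)^m, the identity g p_m = p_m - p_(m+1) telescopes the geometric series to p_0 =
-- 1.
recip-inverseˡ : ∀ g → g 0 ≡ 1ℤ → recip g ⊛ g ≈ 𝟏
recip-inverseˡ g g0≡1 = R.trans (⊛-comm (recip g) g) (hasSum-unique
  (hasSum-⊛ g (Σ∞-hasSum powers-vanish))
  (hasSum-telescope (λ m → (𝟏 ⊖ g) ⊛^ m) powers-vanish λ m →
    solve 2 (λ g p → g :* p := p :- (con 1ℤ :- g) :* p) refl g ((𝟏 ⊖ g) ⊛^ m)))
  where
  powers-vanish : ∀ m → VanishesBelow m ((𝟏 ⊖ g) ⊛^ m)
  powers-vanish m = vanishesBelow-⊛^ m (cong (λ a → 1ℤ ℤ.- a) g0≡1)

⊘-cancel : ∀ f g → g 0 ≡ 1ℤ → (f ⊘ g) ⊛ g ≈ f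
⊘-cancel f g g0≡1 = R.trans (R.*-assoc f (recip g) g) (R.trans
  (⊛-congˡ f (recip-inverseˡ g g0≡1))
  (R.*-identityʳ f))

recip-cancelˡ : ∀ g → g 0 ≡ 1ℤ → ∀ f → recip g ⊛ (g ⊛ f) ≈ f
recip-cancelˡ g g0≡1 f = R.trans (R.sym (R.*-assoc (recip g) g f)) (R.trans
  (⊛-congʳ f (recip-inverseˡ g g0≡1))
  (R.*-identityˡ f))

⊛-cancelˡ : ∀ g → g 0 ≡ 1ℤ → ∀ f h → g ⊛ f ≈ g ⊛ h → f ≈ h
⊛-cancelˡ g g0≡1 f h gf≈gh = R.trans (R.sym (recip-cancelˡ g g0≡1 f))
  (R.trans (⊛-congˡ (recip g) gf≈gh) (recip-cancelˡ g g0≡1 h))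

vanishesBelow-⊛⁻ˡ : ∀ {k} f g → g 0 ≡ 1ℤ → VanishesBelow k (g ⊛ f) → VanishesBelow k f
vanishesBelow-⊛⁻ˡ f g g0≡1 v = vanishing λ n n<k →
  trans (sym (coeff (recip-cancelˡ g g0≡1 f) n)) (vanishes (vanishesBelow-⊛ʳ (recip g) v) n n<k)

-- Reasoning modulo a known equation: the last hypothesis is typically a polynomial identity for the
-- ring solver, and `c` is the multiplier of `a ≈ b`. Nested uses combine several equations
-- linearly.
≈-modulo : ∀ {a b l r} c → a ≈ b → l ≈ r ⊕ c ⊛ (a ⊖ b) → l ≈ r
≈-modulo {b = b} {r = r} c a≈b l≈ = R.trans l≈ (R.trans
  (R.+-congˡ {r} (⊛-congˡ c (R.+-congʳ {⊖ b} a≈b)))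
  (solve 3 (λ r c b → r :+ c :* (b :- b) := r) refl r c b))

q^-cong : ∀ {a b} → a ≡ b → q^ a ≈ q^ b
q^-cong refl = R.refl

q^-+ : ∀ a b → q^ (a + b) ≈ q^ a ⊛ q^ b
q^-+ zero    b = R.sym (R.*-identityˡ (q^ b))
q^-+ (suc a) b = pointwise λ
  { zero    → refl
  ; (suc n) → trans (coeff (q^-+ a b) n) (sym (ℤₚ.+-identityˡ _)) }

q^-split : ∀ {a} b c → a ≡ b + c → q^ a ≈ q^ b ⊛ q^ c
q^-split b c refl = q^-+ b c

q^-⊛^ : ∀ a m → (q^ a) ⊛^ m ≈ q^ (m * a)
q^-⊛^ a zero    = R.refl
q^-⊛^ a (suc m) = R.trans (⊛-congˡ (q^ a) (q^-⊛^ a m)) (R.sym (q^-+ a (m * a)))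

⊛^-cong : ∀ m → f ≈ g → f ⊛^ m ≈ g ⊛^ m
⊛^-cong zero    f≈g = R.refl
⊛^-cong (suc m) f≈g = R.*-cong f≈g (⊛^-cong m f≈g)

⊛^-distrib-⊛ : ∀ f g m → (f ⊛ g) ⊛^ m ≈ f ⊛^ m ⊛ g ⊛^ m
⊛^-distrib-⊛ f g zero    = R.sym (R.*-identityˡ 𝟏)
⊛^-distrib-⊛ f g (suc m) = R.trans (⊛-congˡ (f ⊛ g) (⊛^-distrib-⊛ f g m))
  (solve 4 (λ f g a b → f :* g :* (a :* b) := f :* a :* (g :* b)) refl f g (f ⊛^ m) (g ⊛^ m))

⊛^-+ : ∀ f m n → f ⊛^ (m + n) ≈ f ⊛^ m ⊛ f ⊛^ n
⊛^-+ f zero    n = R.sym (R.*-identityˡ (f ⊛^ n))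
⊛^-+ f (suc m) n = R.trans (⊛-congˡ f (⊛^-+ f m n)) (R.sym (R.*-assoc f (f ⊛^ m) (f ⊛^ n)))

-- Gauss's identity

t : ℤ⟦q⟧
t = q^ 8

-- `y n` is t^(2n), `x n` is t^(2n+1) and `u n` is the u_n of the header. `y (suc n)` unfolds to
-- `t ⊛ t ⊛ y n`, which suits the ring solver.
y x u : ℕ → ℤ⟦q⟧
y n = (t ⊛ t) ⊛^ n
x n = t ⊛ y n
u n = qPoch (q^ 8) (q^ 16) n ⊘ qPoch (q^ 16) (q^ 16) n

x≈q^ : ∀ n → x n ≈ q^ (8 + 16 * n)
x≈q^ n = R.trans (⊛-congˡ t y≈q^) (R.sym (q^-+ 8 (16 * n)))
  where
  y≈q^ : y n ≈ q^ (16 * n)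
  y≈q^ = R.trans (⊛^-cong n (R.sym (q^-+ 8 8))) (R.trans (q^-⊛^ 16 n) (q^-cong (ℕₚ.*-comm n 16)))

-- A successor exponent makes every factor start with 1; hence the arguments 7 and 15 for q^8 and
-- q^16 below.
qPoch-constant : ∀ a m → qPoch (q^ suc a) (q^ 16) m 0 ≡ 1ℤ
qPoch-constant a zero    = refl
qPoch-constant a (suc m) = cong (λ b → b ℤ.* 1ℤ ℤ.+ 0ℤ) (qPoch-constant a m)

u-constant : ∀ m → u m 0 ≡ 1ℤ
u-constant m = cong (λ b → b ℤ.* 1ℤ ℤ.+ 0ℤ) (qPoch-constant 7 m)

-- The ratio of consecutive u's is (1 - t^(2m+1)) / (1 - t^(2m+2)), verified after multiplication by
-- the denominator `D m`.
u-suc : ∀ m → u (suc m) ⊛ (𝟏 ⊖ t ⊛ x m) ≈ u m ⊛ (𝟏 ⊖ x m)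
u-suc m = ⊛-cancelˡ (D m) (qPoch-constant 15 m) _ _ (begin
  D m ⊛ (u (suc m) ⊛ (𝟏 ⊖ t ⊛ x m))
    ≈⟨ solve 3 (λ d v e → d :* (v :* e) := v :* (d :* e)) refl (D m) (u (suc m)) (𝟏 ⊖ t ⊛ x m) ⟩
  u (suc m) ⊛ (D m ⊛ (𝟏 ⊖ t ⊛ x m))
    ≈⟨ ⊛-congˡ (u (suc m)) (qPoch-suc 16 (R.trans (⊛-congʳ (y m) (q^-+ 8 8)) (R.*-assoc t t (y m)))) ⟨
  u (suc m) ⊛ D (suc m)         ≈⟨ ⊘-cancel (N (suc m)) (D (suc m)) (qPoch-constant 15 (suc m)) ⟩
  N (suc m)                     ≈⟨ qPoch-suc 8 R.refl ⟩
  N m ⊛ (𝟏 ⊖ x m)               ≈⟨ ⊛-congʳ (𝟏 ⊖ x m) (⊘-cancel (N m) (D m) (qPoch-constant 15 m)) ⟨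
  u m ⊛ D m ⊛ (𝟏 ⊖ x m)
    ≈⟨ solve 3 (λ d v e → v :* d :* e := d :* (v :* e)) refl (D m) (u m) (𝟏 ⊖ x m) ⟩
  D m ⊛ (u m ⊛ (𝟏 ⊖ x m))       ∎)
  where
  open import Relation.Binary.Reasoning.Setoid R.setoid
  N D : ℕ → ℤ⟦q⟧
  N = qPoch (q^ 8) (q^ 16)
  D = qPoch (q^ 16) (q^ 16)
  qPoch-suc : ∀ a {f} → q^ a ⊛ y m ≈ f → qPoch (q^ a) (q^ 16) (suc m) ≈ qPoch (q^ a) (q^ 16) m ⊛ (𝟏 ⊖ f)
  qPoch-suc a q^a·y≈f = ⊛-congˡ (qPoch (q^ a) (q^ 16) m) (R.+-congˡ {𝟏} (R.-‿cong
    (R.trans (⊛-congˡ (q^ a) (⊛^-cong m (q^-+ 8 8))) q^a·y≈f)))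

-- `x (m + n)` is factored as `x n ⊛ y m`, which isolates the dependence on the summation index `m`.
u-suc-+ : ∀ m n → u (suc (m + n)) ⊛ (𝟏 ⊖ t ⊛ x n ⊛ y m) ≈ u (m + n) ⊛ (𝟏 ⊖ x n ⊛ y m)
u-suc-+ m n = R.trans
  (⊛-congˡ (u (suc (m + n))) (R.+-congˡ {𝟏} (R.-‿cong
    (R.trans (R.*-assoc t (x n) (y m)) (⊛-congˡ t (R.sym x[m+n]))))))
  (R.trans (u-suc (m + n)) (⊛-congˡ (u (m + n)) (R.+-congˡ {𝟏} (R.-‿cong x[m+n]))))
  where
  x[m+n] : x (m + n) ≈ x n ⊛ y m
  x[m+n] = R.trans (⊛-congˡ t (⊛^-+ (t ⊛ t) m n))
    (solve 3 (λ t a b → t :* (a :* b) := t :* b :* a) refl t (y m) (y n))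

u₀≈𝟏 : u 0 ≈ 𝟏
u₀≈𝟏 = R.trans (R.sym (R.*-identityʳ (u 0))) (⊘-cancel 𝟏 𝟏 refl)

-- In the notation of the header, θ 0 n = F(t^{2n+1}) and θ n n = S_n.
θ-term : ℕ → ℕ → ℕ → ℤ⟦q⟧
θ-term k n m = u (m + k) ⊛ x n ⊛^ m

θ : ℕ → ℕ → ℤ⟦q⟧
θ k n = Σ∞ (θ-term k n)

θ-hasSum : ∀ k n → θ-term k n HasSum θ k n
θ-hasSum k n = Σ∞-hasSum λ m → vanishesBelow-⊛ʳ (u (m + k)) (vanishesBelow-⊛^ {f = x n} m refl)

-- Since x_(n+1) = t² x_n, the shift of the argument becomes a factor `y m`, and the powers are
-- again those of `x n`.
θ-suc-hasSum : ∀ k n → (λ m → u (m + k) ⊛ (y m ⊛ x n ⊛^ m)) HasSum θ k (suc n)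
θ-suc-hasSum k n = hasSum-cong (λ m → ⊛-congˡ (u (m + k)) (R.trans (⊛^-cong m
    (solve 2 (λ t y → t :* (t :* t :* y) := t :* t :* (t :* y)) refl t (y n)))
    (⊛^-distrib-⊛ (t ⊛ t) (x n) m))) R.refl (θ-hasSum k (suc n))

-- Telescoping with a certificate `T`: a termwise identity yields a q-difference equation whose
-- inhomogeneous term is `T 0`.
θ-difference : ∀ a b k n l → ∀ T → (∀ m → VanishesBelow m (T m)) →
  (∀ m → a ⊛ θ-term k n m ⊖ b ⊛ (u (m + l) ⊛ (y m ⊛ x n ⊛^ m)) ≈ T m ⊖ T (suc m)) →
  a ⊛ θ k n ⊖ b ⊛ θ l (suc n) ≈ T 0
θ-difference a b k n l T T-v step = hasSum-unique
  (hasSum-⊕ (hasSum-⊛ a (θ-hasSum k n)) (hasSum-⊖ (hasSum-⊛ b (θ-suc-hasSum l n))))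
  (hasSum-telescope T T-v step)

θ-shift : ∀ n → (𝟏 ⊖ x n) ⊛ θ 0 n ≈ (𝟏 ⊖ t ⊛ x n) ⊛ θ 0 (suc n)
θ-shift n = ≈-modulo 𝟏
  (θ-difference (𝟏 ⊖ x n) (𝟏 ⊖ t ⊛ x n) 0 n 0 T
    (λ m → vanishesBelow-⊛ʳ (u (m + 0) ⊛ (𝟏 ⊖ y m)) (vanishesBelow-⊛^ {f = x n} m refl))
    step)
  (solve 3 (λ a b U → a := b :+ con 1ℤ :* (a :- b :- U :* (con 1ℤ :- con 1ℤ) :* con 1ℤ)) refl
    ((𝟏 ⊖ x n) ⊛ θ 0 n) ((𝟏 ⊖ t ⊛ x n) ⊛ θ 0 (suc n)) (u 0))
  where
  T : ℕ → ℤ⟦q⟧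
  -- `y 0` is `𝟏`, so `T 0` vanishes and the equation is homogeneous.
  T m = u (m + 0) ⊛ (𝟏 ⊖ y m) ⊛ x n ⊛^ m
  step : ∀ m → (𝟏 ⊖ x n) ⊛ θ-term 0 n m ⊖ (𝟏 ⊖ t ⊛ x n) ⊛ (u (m + 0) ⊛ (y m ⊛ x n ⊛^ m)) ≈ T m ⊖ T (suc m)
  -- The multiplier of the recurrence for u is x_n^(m+1); `t :* con 1ℤ` is `x 0` unfolded.
  step m = ≈-modulo (x n ⊛ x n ⊛^ m) (u-suc-+ m 0)
    (solve 6 (λ t z Y P U U′ →
      (con 1ℤ :- z) :* (U :* P) :- (con 1ℤ :- t :* z) :* (U :* (Y :* P)) :=
      U :* (con 1ℤ :- Y) :* P :- U′ :* (con 1ℤ :- t :* t :* Y) :* (z :* P)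
      :+ z :* P :* (U′ :* (con 1ℤ :- t :* (t :* con 1ℤ) :* Y) :- U :* (con 1ℤ :- t :* con 1ℤ :* Y)))
      refl t (x n) (y m) (x n ⊛^ m) (u (m + 0)) (u (suc (m + 0))))

θ-diagonal : ∀ n → (𝟏 ⊖ x n) ⊛ θ n n ⊖ t ⊛ x n ⊛ x n ⊛ (𝟏 ⊖ t ⊛ x n) ⊛ θ (suc n) (suc n) ≈ u n ⊛ (𝟏 ⊖ x n ⊛ x n)
θ-diagonal n = R.trans
  (θ-difference (𝟏 ⊖ x n) (t ⊛ x n ⊛ x n ⊛ (𝟏 ⊖ t ⊛ x n)) n n (suc n) T
    (λ m → vanishesBelow-⊛ʳ (u (m + n) ⊛ (𝟏 ⊖ x n ⊛ x n ⊛ y m)) (vanishesBelow-⊛^ {f = x n} m refl))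
    step)
  (solve 2 (λ z U → U :* (con 1ℤ :- z :* z :* con 1ℤ) :* con 1ℤ := U :* (con 1ℤ :- z :* z)) refl (x n) (u n))
  where
  T : ℕ → ℤ⟦q⟧
  -- The extra factor x_n² beside `y m` makes `T 0` the inhomogeneous term u_n (1 - x_n²).
  T m = u (m + n) ⊛ (𝟏 ⊖ x n ⊛ x n ⊛ y m) ⊛ x n ⊛^ m
  identity : ∀ t z Y P U U′ →
    (𝟏 ⊖ z) ⊛ (U ⊛ P) ⊖ t ⊛ z ⊛ z ⊛ (𝟏 ⊖ t ⊛ z) ⊛ (U′ ⊛ (Y ⊛ P)) ≈
    (U ⊛ (𝟏 ⊖ z ⊛ z ⊛ Y) ⊛ P ⊖ U′ ⊛ (𝟏 ⊖ z ⊛ z ⊛ (t ⊛ t ⊛ Y)) ⊛ (z ⊛ P))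
    ⊕ z ⊛ P ⊛ (U′ ⊛ (𝟏 ⊖ t ⊛ z ⊛ Y) ⊖ U ⊛ (𝟏 ⊖ z ⊛ Y))
  identity = solve 6 (λ t z Y P U U′ →
      (con 1ℤ :- z) :* (U :* P) :- t :* z :* z :* (con 1ℤ :- t :* z) :* (U′ :* (Y :* P)) :=
      U :* (con 1ℤ :- z :* z :* Y) :* P :- U′ :* (con 1ℤ :- z :* z :* (t :* t :* Y)) :* (z :* P)
      :+ z :* P :* (U′ :* (con 1ℤ :- t :* z :* Y) :- U :* (con 1ℤ :- z :* Y))) refl
  step : ∀ m → (𝟏 ⊖ x n) ⊛ θ-term n n m
               ⊖ t ⊛ x n ⊛ x n ⊛ (𝟏 ⊖ t ⊛ x n) ⊛ (u (m + suc n) ⊛ (y m ⊛ x n ⊛^ m)) ≈ T m ⊖ T (suc m)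
  step m = ≈-modulo (x n ⊛ x n ⊛^ m) (u-suc-+ m n) (R.trans
    (R.+-congˡ {(𝟏 ⊖ x n) ⊛ θ-term n n m} (R.-‿cong (⊛-congˡ (t ⊛ x n ⊛ x n ⊛ (𝟏 ⊖ t ⊛ x n))
      (⊛-congʳ (y m ⊛ x n ⊛^ m) (R.reflexive (cong u (ℕₚ.+-suc m n)))))))
    (identity t (x n) (y m) (x n ⊛^ m) (u (m + n)) (u (suc (m + n)))))

-- Both sides obey the same first-order recurrence in `n`, by `θ-shift` and `u-suc`.
θ-shifts : ∀ n → θ 0 n ≈ u n ⊛ θ 0 0
θ-shifts zero    = R.sym (R.trans (⊛-congʳ (θ 0 0) u₀≈𝟏) (R.*-identityˡ (θ 0 0)))
θ-shifts (suc n) = ⊛-cancelˡ (𝟏 ⊖ t ⊛ x n) refl _ _ (begin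
  (𝟏 ⊖ t ⊛ x n) ⊛ θ 0 (suc n)                ≈⟨ θ-shift n ⟨
  (𝟏 ⊖ x n) ⊛ θ 0 n                         ≈⟨ ⊛-congˡ (𝟏 ⊖ x n) (θ-shifts n) ⟩
  (𝟏 ⊖ x n) ⊛ (u n ⊛ θ 0 0)                 ≈⟨ shuffle (𝟏 ⊖ x n) (u n) (θ 0 0) ⟩
  u n ⊛ (𝟏 ⊖ x n) ⊛ θ 0 0                   ≈⟨ ⊛-congʳ (θ 0 0) (u-suc n) ⟨
  u (suc n) ⊛ (𝟏 ⊖ t ⊛ x n) ⊛ θ 0 0         ≈⟨ shuffle (𝟏 ⊖ t ⊛ x n) (u (suc n)) (θ 0 0) ⟨
  (𝟏 ⊖ t ⊛ x n) ⊛ (u (suc n) ⊛ θ 0 0)       ∎)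
  where
  open import Relation.Binary.Reasoning.Setoid R.setoid
  shuffle : ∀ a b c → a ⊛ (b ⊛ c) ≈ b ⊛ a ⊛ c
  shuffle = solve 3 (λ a b c → a :* (b :* c) := b :* a :* c) refl

square : ℕ → ℤ⟦q⟧
square k = q^ ((2 * k + 1) ^ 2)

-- By `u-suc`, dividing `θ-diagonal` by (1 - x_n) u_n gives S_n/u_n = 1 + x_n + t x_n²
-- S_(n+1)/u_(n+1). With w = q^((4n+1)²), the products w, w x_n and w t x_n² are three consecutive
-- odd squares in the exponent. The factor `u n` clears denominators.
gauss-partial : ∀ n → u n ⊛ (q^ 1 ⊛ θ 0 0) ≈ u n ⊛ ⨁ (n + n) square ⊕ square (n + n) ⊛ θ n n
gauss-partial zero    = R.trans
  (R.trans (⊛-congʳ (q^ 1 ⊛ θ 0 0) u₀≈𝟏) (R.*-identityˡ (q^ 1 ⊛ θ 0 0)))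
  (R.sym (R.trans (R.+-congʳ {q^ 1 ⊛ θ 0 0} (R.zeroʳ (u 0))) (R.+-identityˡ (q^ 1 ⊛ θ 0 0))))
gauss-partial (suc n) = ⊛-cancelˡ (𝟏 ⊖ t ⊛ z) refl _ _ (R.trans
  -- The multipliers of the recurrence, the induction hypothesis and `θ-diagonal` are chosen to
  -- eliminate `u n` and `θ n n`.
  (≈-modulo (Q ⊖ Θ ⊖ w ⊖ w ⊛ z) (u-suc n)
    (≈-modulo (𝟏 ⊖ z) (gauss-partial n)
      (≈-modulo w (θ-diagonal n)
        (identity t z w Θ Q (θ n n) (θ (suc n) (suc n)) (u n) (u (suc n))))))
  (⊛-congˡ (𝟏 ⊖ t ⊛ z) (R.+-cong (⊛-congˡ (u (suc n)) (R.sym ⨁-square)) (⊛-congʳ (θ (suc n) (suc n)) (R.sym square-suc-suc)))))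
  where
  z w Θ Q : ℤ⟦q⟧
  z = x n
  w = square (n + n)
  Θ = ⨁ (n + n) square
  Q = q^ 1 ⊛ θ 0 0
  identity : ∀ t z w Θ Q S S′ U U′ →
    (𝟏 ⊖ t ⊛ z) ⊛ (U′ ⊛ Q) ≈
    (𝟏 ⊖ t ⊛ z) ⊛ (U′ ⊛ (Θ ⊕ w ⊕ w ⊛ z) ⊕ w ⊛ (t ⊛ z ⊛ z) ⊛ S′)
    ⊕ (Q ⊖ Θ ⊖ w ⊖ w ⊛ z) ⊛ (U′ ⊛ (𝟏 ⊖ t ⊛ z) ⊖ U ⊛ (𝟏 ⊖ z))
    ⊕ (𝟏 ⊖ z) ⊛ (U ⊛ Q ⊖ (U ⊛ Θ ⊕ w ⊛ S))
    ⊕ w ⊛ (((𝟏 ⊖ z) ⊛ S ⊖ t ⊛ z ⊛ z ⊛ (𝟏 ⊖ t ⊛ z) ⊛ S′) ⊖ U ⊛ (𝟏 ⊖ z ⊛ z))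
  identity = solve 9 (λ t z w Θ Q S S′ U U′ →
    (con 1ℤ :- t :* z) :* (U′ :* Q) :=
    (con 1ℤ :- t :* z) :* (U′ :* (Θ :+ w :+ w :* z) :+ w :* (t :* z :* z) :* S′)
    :+ (Q :- Θ :- w :- w :* z) :* (U′ :* (con 1ℤ :- t :* z) :- U :* (con 1ℤ :- z))
    :+ (con 1ℤ :- z) :* (U :* Q :- (U :* Θ :+ w :* S))
    :+ w :* (((con 1ℤ :- z) :* S :- t :* z :* z :* (con 1ℤ :- t :* z) :* S′) :- U :* (con 1ℤ :- z :* z))) refl
  square-suc : square (suc (n + n)) ≈ w ⊛ z
  square-suc = R.trans (q^-split ((2 * (n + n) + 1) ^ 2) (8 + 16 * n) (exponent n)) (⊛-congˡ w (R.sym (x≈q^ n)))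
    where
    -- The squares are unfolded because the solver does not recognise _^_.
    exponent : ∀ n → (2 * suc (n + n) + 1) * ((2 * suc (n + n) + 1) * 1) ≡
               (2 * (n + n) + 1) * ((2 * (n + n) + 1) * 1) + (8 + 16 * n)
    exponent = ℕ-RingSolver.solve-∀
  square-suc-suc : square (suc n + suc n) ≈ w ⊛ (t ⊛ z ⊛ z)
  square-suc-suc = R.trans (q^-split ((2 * (n + n) + 1) ^ 2) (8 + (8 + 16 * n) + (8 + 16 * n)) (exponent n))
    (⊛-congˡ w (R.trans (q^-+ (8 + (8 + 16 * n)) (8 + 16 * n))
      (R.*-cong (R.trans (q^-+ 8 (8 + 16 * n)) (⊛-congˡ t (R.sym (x≈q^ n)))) (R.sym (x≈q^ n)))))
    where
    exponent : ∀ n → (2 * (suc n + suc n) + 1) * ((2 * (suc n + suc n) + 1) * 1) ≡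
               (2 * (n + n) + 1) * ((2 * (n + n) + 1) * 1) + (8 + (8 + 16 * n) + (8 + 16 * n))
    exponent = ℕ-RingSolver.solve-∀
  ⨁-square : ⨁ (suc n + suc n) square ≈ Θ ⊕ w ⊕ w ⊛ z
  ⨁-square = R.trans (R.reflexive (cong (λ M → ⨁ (suc M) square) (ℕₚ.+-suc n n)))
    (R.trans (⨁-last (suc (n + n)) square) (R.+-cong (⨁-last (n + n) square) square-suc))

vanishesBelow-square : ∀ k → VanishesBelow k (square k)
vanishesBelow-square k = vanishesBelow-≤
  (ℕₚ.≤-trans (ℕₚ.m≤m+n k _) (ℕₚ.≤-reflexive (sym (exponent k))))
  (vanishesBelow-q^ ((2 * k + 1) ^ 2))
  where
  exponent : ∀ k → (2 * k + 1) * ((2 * k + 1) * 1) ≡ k + (3 * k + 4 * k * k + 1)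
  exponent = ℕ-RingSolver.solve-∀

gauss-remainder : ∀ k → u k ⊛ (q^ 1 ⊛ θ 0 0 ⊖ ⨁ (k + k) square) ≈ square (k + k) ⊛ θ k k
gauss-remainder k = ≈-modulo 𝟏 (gauss-partial k)
  (identity (u k) (q^ 1 ⊛ θ 0 0) (⨁ (k + k) square) (square (k + k) ⊛ θ k k))
  where
  identity : ∀ U Q Θ S → U ⊛ (Q ⊖ Θ) ≈ S ⊕ 𝟏 ⊛ (U ⊛ Q ⊖ (U ⊛ Θ ⊕ S))
  identity = solve 4 (λ U Q Θ S → U :* (Q :- Θ) := S :+ con 1ℤ :* (U :* Q :- (U :* Θ :+ S))) refl

-- The remainder carries the factor `square (k + k)`, and `u k` is a unit.
gauss-modulo : ∀ k → VanishesBelow (k + k) (q^ 1 ⊛ θ 0 0 ⊖ ⨁ (k + k) square)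
gauss-modulo k = vanishesBelow-⊛⁻ˡ _ (u k) (u-constant k) (vanishing λ m m<2k → trans
  (coeff (gauss-remainder k) m)
  (vanishes (vanishesBelow-⊛ˡ (θ k k) (vanishesBelow-square (k + k))) m m<2k))

gauss : q^ 1 ⊛ θ 0 0 ≈ Σ∞ square
gauss = pointwise λ n →
  let N , p = sumsTo (Σ∞-hasSum vanishesBelow-square) n
      -- Then 2k exceeds `n`, where the remainder must vanish, and is at least `N`, where the
      -- partial sums are stable.
      k = N + suc n
  in trans
    (ℤₚ.i-j≡0⇒i≡j ((q^ 1 ⊛ θ 0 0) n) (⨁ (k + k) square n)
      (vanishes (gauss-modulo k) n (ℕₚ.≤-trans (ℕₚ.m≤n+m (suc n) N) (ℕₚ.m≤m+n k k))))
    (p (k + k) (ℕₚ.≤-trans (ℕₚ.m≤m+n N (suc n)) (ℕₚ.m≤m+n k k)))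

-- Column 0

q^-⊛-cong : ∀ {a b c d} → a + b ≡ c + d → q^ a ⊛ q^ b ≈ q^ c ⊛ q^ d
q^-⊛-cong {a} {b} {c} {d} eq = R.trans (R.sym (q^-+ a b)) (q^-split c d eq)

-- As (4i+1)(4m+1) + 4m = 4i+1 + m(16i+8), the sum is q^(4i+1) times `θ 0 i`; `θ-shifts` extracts
-- `X i 0` and `gauss` leaves `B 0 0`.
AX-column₀ : ∀ i → (λ m → A i m ⊛ X m 0) HasSum (X i 0 ⊛ B 0 0)
AX-column₀ i = hasSum-cong term total (hasSum-⊛ (q^ (4 * i + 1)) (θ-hasSum 0 i))
  where
  x-power : ∀ m → x i ⊛^ m ≈ q^ (m * (8 + 16 * i))
  x-power m = R.trans (⊛^-cong m (x≈q^ i)) (q^-⊛^ (8 + 16 * i) m)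
  exponents : ∀ i m → 4 * i + 1 + m * (8 + 16 * i) ≡ (4 * i + 1) * (4 * m + 1) + 4 * m
  exponents = ℕ-RingSolver.solve-∀
  term : ∀ m → q^ (4 * i + 1) ⊛ θ-term 0 i m ≈ A i m ⊛ X m 0
  term m = begin
    q^ (4 * i + 1) ⊛ (u (m + 0) ⊛ x i ⊛^ m)
      ≈⟨ ⊛-congˡ (q^ (4 * i + 1)) (R.*-cong (R.reflexive (cong u (ℕₚ.+-identityʳ m))) (x-power m)) ⟩
    q^ (4 * i + 1) ⊛ (u m ⊛ q^ (m * (8 + 16 * i)))
      ≈⟨ shuffle (q^ (4 * i + 1)) (u m) (q^ (m * (8 + 16 * i))) ⟩
    u m ⊛ (q^ (4 * i + 1) ⊛ q^ (m * (8 + 16 * i)))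
      ≈⟨ ⊛-congˡ (u m) (q^-⊛-cong {4 * i + 1} {_} {(4 * i + 1) * (4 * m + 1)} (exponents i m)) ⟩
    u m ⊛ (A i m ⊛ q^ (4 * m))
      ≈⟨ shuffle (u m) (A i m) (q^ (4 * m)) ⟩
    A i m ⊛ X m 0 ∎
    where
    open import Relation.Binary.Reasoning.Setoid R.setoid
    shuffle : ∀ a b c → a ⊛ (b ⊛ c) ≈ b ⊛ (a ⊛ c)
    shuffle = solve 3 (λ a b c → a :* (b :* c) := b :* (a :* c)) refl
  total : q^ (4 * i + 1) ⊛ θ 0 i ≈ X i 0 ⊛ B 0 0
  total = begin
    q^ (4 * i + 1) ⊛ θ 0 i
      ≈⟨ R.*-cong (q^-+ (4 * i) 1) (θ-shifts i) ⟩
    q^ (4 * i) ⊛ q^ 1 ⊛ (u i ⊛ θ 0 0)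
      ≈⟨ shuffle (q^ (4 * i)) (q^ 1) (u i) (θ 0 0) ⟩
    u i ⊛ q^ (4 * i) ⊛ (q^ 1 ⊛ θ 0 0)
      ≈⟨ ⊛-congˡ (X i 0) gauss ⟩
    X i 0 ⊛ B 0 0 ∎
    where
    open import Relation.Binary.Reasoning.Setoid R.setoid
    shuffle : ∀ a b c d → a ⊛ b ⊛ (c ⊛ d) ≈ c ⊛ a ⊛ (b ⊛ d)
    shuffle = solve 4 (λ a b c d → a :* b :* (c :* d) := c :* a :* (b :* d)) refl

XB-column₀ : ∀ i → (λ m → X i m ⊛ B m 0) HasSum (X i 0 ⊛ B 0 0)
XB-column₀ i = hasSum-cong (λ m → R.refl) (R.trans (R.+-identityʳ _) (R.+-identityʳ _))
  (hasSum-prefix 1 (hasSum-cong (λ m → R.sym (R.zeroʳ (X i (suc m)))) R.refl hasSum-𝟎))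

-- The columns j + 1

-- The geometric series of ratio q^(b_s). Up to sign, the entries of `X` outside column 0 have this
-- form, with s = i - j or s = j - i - 1.
frac : ℕ → ℕ → ℤ⟦q⟧
frac a s = q^ a ⊘ (𝟏 ⊖ q^ (16 * s + 8))

frac-cong : ∀ {a b} s → a ≡ b → frac a s ≈ frac b s
frac-cong s refl = R.refl

frac-⊛ : ∀ a b s → frac a s ⊛ q^ b ≈ frac (a + b) s
frac-⊛ a b s = R.trans
  (solve 3 (λ a b r → a :* r :* b := a :* b :* r) refl (q^ a) (q^ b) (recip (𝟏 ⊖ q^ (16 * s + 8))))
  (⊛-congʳ (recip (𝟏 ⊖ q^ (16 * s + 8))) (R.sym (q^-+ a b)))

frac-step : ∀ a s → frac a s ≈ q^ a ⊕ frac (a + (16 * s + 8)) s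
frac-step a s = R.trans
  (≈-modulo (q^ a) (recip-inverseˡ (𝟏 ⊖ Q) constant-1)
    (identity (q^ a) Q (recip (𝟏 ⊖ Q))))
  (R.+-congˡ {q^ a} (frac-⊛ a (16 * s + 8) s))
  where
  Q : ℤ⟦q⟧
  Q = q^ (16 * s + 8)
  constant-1 : (𝟏 ⊖ Q) 0 ≡ 1ℤ
  constant-1 = cong (λ b → 1ℤ ℤ.- b) (vanishes (vanishesBelow-q^ (16 * s + 8)) 0 (ℕₚ.≤-trans z<s (ℕₚ.m≤n+m 8 (16 * s))))
  identity : ∀ a q r → a ⊛ r ≈ a ⊕ a ⊛ r ⊛ q ⊕ a ⊛ (r ⊛ (𝟏 ⊖ q) ⊖ 𝟏)
  identity = solve 3 (λ a q r → a :* r := a :+ a :* r :* q :+ a :* (r :* (con 1ℤ :- q) :- con 1ℤ)) refl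

-- Raises the exponent by K b_s at the cost of `K` monomials.
frac-expand : ∀ K a s → frac a s ≈ ⨁ K (λ k → q^ (a + k * (16 * s + 8))) ⊕ frac (a + K * (16 * s + 8)) s
frac-expand zero    a s = R.trans (frac-cong s (sym (ℕₚ.+-identityʳ a))) (R.sym (R.+-identityˡ _))
frac-expand (suc K) a s = begin
  frac a s                      ≈⟨ frac-step a s ⟩
  q^ a ⊕ frac (a + b) s         ≈⟨ R.+-congˡ {q^ a} (frac-expand K (a + b) s) ⟩
  q^ a ⊕ (⨁ K (λ k → q^ (a + b + k * b)) ⊕ frac (a + b + K * b) s)
    ≈⟨ R.+-assoc (q^ a) _ _ ⟨
  q^ a ⊕ ⨁ K (λ k → q^ (a + b + k * b)) ⊕ frac (a + b + K * b) s
    ≈⟨ R.+-cong (R.+-cong (q^-cong (sym (ℕₚ.+-identityʳ a))) (⨁-cong K (λ k → q^-cong (ℕₚ.+-assoc a b (k * b)))))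
         (frac-cong s (ℕₚ.+-assoc a b (K * b))) ⟩
  ⨁ (suc K) (λ k → q^ (a + k * b)) ⊕ frac (a + suc K * b) s ∎
  where
  open import Relation.Binary.Reasoning.Setoid R.setoid
  b = 16 * s + 8

vanishesBelow-frac : ∀ {m a} s → m ≤ a → VanishesBelow m (frac a s)
vanishesBelow-frac s m≤a = vanishesBelow-⊛ˡ (recip (𝟏 ⊖ q^ (16 * s + 8))) (vanishesBelow-≤ m≤a (vanishesBelow-q^ _))

geometric-hasSum : ∀ a s → (λ r → q^ (a + r * (16 * s + 8))) HasSum frac a s
geometric-hasSum a s = hasSum-cong (λ r → R.refl) (frac-cong s (ℕₚ.+-identityʳ a))
  (hasSum-telescope (λ r → frac (a + r * b) s)
    (λ r → vanishesBelow-frac s (ℕₚ.≤-trans (r≤r*b r) (ℕₚ.m≤n+m (r * b) a)))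
    (λ r → step r))
  where
  b = 16 * s + 8
  r≤r*b : ∀ r → r ≤ r * b
  r≤r*b r = subst (r ≤_) (cong (r *_) (ℕₚ.+-comm 8 (16 * s))) (ℕₚ.m≤m*n r (8 + 16 * s))
  identity : ∀ p f → p ≈ p ⊕ f ⊖ f
  identity = solve 2 (λ p f → p := p :+ f :- f) refl
  step : ∀ r → q^ (a + r * b) ≈ frac (a + r * b) s ⊖ frac (a + suc r * b) s
  step r = R.trans (identity (q^ (a + r * b)) (frac (a + r * b + b) s))
    (R.+-cong (R.sym (frac-step (a + r * b) s)) (R.-‿cong (frac-cong s (exponent a b (r * b)))))
    where
    exponent : ∀ a b c → a + c + b ≡ a + (b + c)
    exponent = ℕ-RingSolver.solve-∀

-- The exponent c + 8r + 8k + 16rk is symmetric in r and k, so the monomials removed from the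
-- fractions form, for fixed k, a geometric series in r of ratio q^(b_k).
frac-series-hasSum : ∀ c K → (λ r → frac (c + 8 * r + K * (16 * r + 8)) r) HasSum
                     (Σ∞ (λ r → frac (c + 8 * r) r) ⊖ ⨁ K (λ k → frac (c + 8 * k) k))
frac-series-hasSum c K = hasSum-cong term R.refl
  (hasSum-⊕
    (Σ∞-hasSum (λ r → vanishesBelow-frac r (ℕₚ.≤-trans (ℕₚ.m≤n*m r 8) (ℕₚ.m≤n+m (8 * r) c))))
    (hasSum-⊖ (hasSum-⨁ K (λ k →
      hasSum-cong (λ r → q^-cong (exponent c k r)) R.refl (geometric-hasSum (c + 8 * k) k)))))
  where
  exponent : ∀ c k r → c + 8 * k + r * (16 * k + 8) ≡ c + 8 * r + k * (16 * r + 8)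
  exponent = ℕ-RingSolver.solve-∀
  term : ∀ r → frac (c + 8 * r) r ⊖ ⨁ K (λ k → q^ (c + 8 * r + k * (16 * r + 8))) ≈ frac (c + 8 * r + K * (16 * r + 8)) r
  term r = R.trans (R.+-congʳ (frac-expand K (c + 8 * r) r))
    (solve 2 (λ d f → d :+ f :- d := f) refl (⨁ K (λ k → q^ (c + 8 * r + k * (16 * r + 8)))) (frac (c + 8 * r + K * (16 * r + 8)) r))

-- The exponent c of the header.
offset : ℕ → ℕ → ℕ
offset i j = 16 * (i * j) + 12 * i + 4 * j + 5

-- The terms of both products as fractions.

<ᵇ-true : ∀ i r → (i <ᵇ suc (i + r)) ≡ true
<ᵇ-true zero    r = refl
<ᵇ-true (suc i) r = <ᵇ-true i r

<ᵇ-false : ∀ j s → (j + s <ᵇ j) ≡ false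
<ᵇ-false zero    zero    = refl
<ᵇ-false zero    (suc s) = refl
<ᵇ-false (suc j) s       = <ᵇ-false j s

X-left : ∀ j s → X (suc j + s) (suc j) ≡ frac (4 * s) s
X-left j s rewrite <ᵇ-false j s | ℕₚ.m+n∸m≡n j s = refl

X-right : ∀ i r → X i (suc (i + r)) ≡ ⊖ frac (12 * r + 4) r
X-right i r rewrite <ᵇ-true i r | ℕₚ.+-∸-assoc 1 (ℕₚ.m≤m+n i r) | ℕₚ.m+n∸m≡n i r = refl

-- Removes the truncated subtraction, so that exponents become polynomials.
B-positive : ∀ m j → B (suc m) (suc j) ≡ ⊖ q^ ((4 * m + 3) * (4 * j + 3))
B-positive m j = cong₂ (λ a b → ⊖ q^ (a * b)) (4*suc∸1 m) (4*suc∸1 j)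
  where
  4*suc : ∀ m → 4 * suc m ≡ 4 * m + 3 + 1
  4*suc = ℕ-RingSolver.solve-∀
  4*suc∸1 : ∀ m → 4 * suc m ∸ 1 ≡ 4 * m + 3
  4*suc∸1 m = trans (cong (_∸ 1) (4*suc m)) (ℕₚ.m+n∸n≡m (4 * m + 3) 1)

frac-⊛-⊖ : ∀ a b s → frac a s ⊛ (⊖ q^ b) ≈ ⊖ frac (a + b) s
frac-⊛-⊖ a b s = R.trans
  (solve 2 (λ f q → f :* (:- q) := :- (f :* q)) refl (frac a s) (q^ b))
  (R.-‿cong (frac-⊛ a b s))

q^-⊛-frac : ∀ a b s → q^ b ⊛ frac a s ≈ frac (a + b) s
q^-⊛-frac a b s = R.trans (⊛-comm (q^ b) (frac a s)) (frac-⊛ a b s)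

-- The row is i = m + 1 + s; exactly `suc j` expansion steps raise the exponent to c + 8s.
XB-left : ∀ j s m → X (suc m + s) (suc m) ⊛ B (suc m) (suc j) ≈
  ⊖ (⨁ (suc j) (λ k → q^ (4 * s + (4 * m + 3) * (4 * j + 3) + k * (16 * s + 8)))
     ⊕ frac (offset (suc m + s) j + 8 * s) s)
XB-left j s m = begin
  X (suc m + s) (suc m) ⊛ B (suc m) (suc j)
    ≈⟨ R.reflexive (cong₂ _⊛_ (X-left m s) (B-positive m j)) ⟩
  frac (4 * s) s ⊛ (⊖ q^ ((4 * m + 3) * (4 * j + 3)))
    ≈⟨ frac-⊛-⊖ (4 * s) ((4 * m + 3) * (4 * j + 3)) s ⟩
  ⊖ frac (4 * s + (4 * m + 3) * (4 * j + 3)) s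
    ≈⟨ R.-‿cong (frac-expand (suc j) (4 * s + (4 * m + 3) * (4 * j + 3)) s) ⟩
  ⊖ (⨁ (suc j) (λ k → q^ (4 * s + (4 * m + 3) * (4 * j + 3) + k * (16 * s + 8)))
     ⊕ frac (4 * s + (4 * m + 3) * (4 * j + 3) + suc j * (16 * s + 8)) s)
    ≈⟨ R.-‿cong (R.+-congˡ {⨁ (suc j) (λ k → q^ (4 * s + (4 * m + 3) * (4 * j + 3) + k * (16 * s + 8)))} (frac-cong s (exponent j s m))) ⟩
  ⊖ (⨁ (suc j) (λ k → q^ (4 * s + (4 * m + 3) * (4 * j + 3) + k * (16 * s + 8)))
     ⊕ frac (offset (suc m + s) j + 8 * s) s) ∎
  where
  open import Relation.Binary.Reasoning.Setoid R.setoid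
  exponent : ∀ j s m → 4 * s + (4 * m + 3) * (4 * j + 3) + suc j * (16 * s + 8) ≡
             16 * ((suc m + s) * j) + 12 * (suc m + s) + 4 * j + 5 + 8 * s
  exponent = ℕ-RingSolver.solve-∀

-- The signs cancel, and the exponent already has the form summed by `frac-series-hasSum`, with `K`
-- equal to `suc j`.
XB-right : ∀ i j r → X i (suc (i + r)) ⊛ B (suc (i + r)) (suc j) ≈
           frac (offset i j + 8 * r + suc j * (16 * r + 8)) r
XB-right i j r = begin
  X i (suc (i + r)) ⊛ B (suc (i + r)) (suc j)
    ≈⟨ R.reflexive (cong₂ _⊛_ (X-right i r) (B-positive (i + r) j)) ⟩
  (⊖ frac (12 * r + 4) r) ⊛ (⊖ q^ ((4 * (i + r) + 3) * (4 * j + 3)))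
    ≈⟨ solve 2 (λ f q → (:- f) :* (:- q) := f :* q) refl (frac (12 * r + 4) r) (q^ ((4 * (i + r) + 3) * (4 * j + 3))) ⟩
  frac (12 * r + 4) r ⊛ q^ ((4 * (i + r) + 3) * (4 * j + 3))
    ≈⟨ frac-⊛ (12 * r + 4) _ r ⟩
  frac (12 * r + 4 + (4 * (i + r) + 3) * (4 * j + 3)) r
    ≈⟨ frac-cong r (exponent i j r) ⟩
  frac (offset i j + 8 * r + suc j * (16 * r + 8)) r ∎
  where
  open import Relation.Binary.Reasoning.Setoid R.setoid
  exponent : ∀ i j r → 12 * r + 4 + (4 * (i + r) + 3) * (4 * j + 3) ≡
             16 * (i * j) + 12 * i + 4 * j + 5 + 8 * r + suc j * (16 * r + 8)
  exponent = ℕ-RingSolver.solve-∀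

-- The counterpart of `XB-left`, with j = m + s and `i` expansion steps.
AX-left : ∀ i m s → A i m ⊛ X m (suc (m + s)) ≈
  ⊖ (⨁ i (λ k → q^ (12 * s + 4 + (4 * i + 1) * (4 * m + 1) + k * (16 * s + 8)))
     ⊕ frac (offset i (m + s) + 8 * s) s)
AX-left i m s = begin
  A i m ⊛ X m (suc (m + s))
    ≈⟨ ⊛-congˡ (A i m) (R.reflexive (X-right m s)) ⟩
  A i m ⊛ (⊖ frac (12 * s + 4) s)
    ≈⟨ solve 2 (λ f q → q :* (:- f) := :- (q :* f)) refl (frac (12 * s + 4) s) (A i m) ⟩
  ⊖ (A i m ⊛ frac (12 * s + 4) s)
    ≈⟨ R.-‿cong (q^-⊛-frac (12 * s + 4) ((4 * i + 1) * (4 * m + 1)) s) ⟩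
  ⊖ frac (12 * s + 4 + (4 * i + 1) * (4 * m + 1)) s
    ≈⟨ R.-‿cong (frac-expand i (12 * s + 4 + (4 * i + 1) * (4 * m + 1)) s) ⟩
  ⊖ (⨁ i (λ k → q^ (12 * s + 4 + (4 * i + 1) * (4 * m + 1) + k * (16 * s + 8)))
     ⊕ frac (12 * s + 4 + (4 * i + 1) * (4 * m + 1) + i * (16 * s + 8)) s)
    ≈⟨ R.-‿cong (R.+-congˡ {⨁ i (λ k → q^ (12 * s + 4 + (4 * i + 1) * (4 * m + 1) + k * (16 * s + 8)))} (frac-cong s (exponent i m s))) ⟩
  ⊖ (⨁ i (λ k → q^ (12 * s + 4 + (4 * i + 1) * (4 * m + 1) + k * (16 * s + 8)))
     ⊕ frac (offset i (m + s) + 8 * s) s) ∎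
  where
  open import Relation.Binary.Reasoning.Setoid R.setoid
  exponent : ∀ i m s → 12 * s + 4 + (4 * i + 1) * (4 * m + 1) + i * (16 * s + 8) ≡
             16 * (i * (m + s)) + 12 * i + 4 * (m + s) + 5 + 8 * s
  exponent = ℕ-RingSolver.solve-∀

AX-right : ∀ i j r → A i (suc j + r) ⊛ X (suc j + r) (suc j) ≈
           frac (offset i j + 8 * r + i * (16 * r + 8)) r
AX-right i j r = begin
  A i (suc j + r) ⊛ X (suc j + r) (suc j)
    ≈⟨ ⊛-congˡ (A i (suc j + r)) (R.reflexive (X-left j r)) ⟩
  A i (suc j + r) ⊛ frac (4 * r) r
    ≈⟨ q^-⊛-frac (4 * r) ((4 * i + 1) * (4 * (suc j + r) + 1)) r ⟩
  frac (4 * r + (4 * i + 1) * (4 * (suc j + r) + 1)) r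
    ≈⟨ frac-cong r (exponent i j r) ⟩
  frac (offset i j + 8 * r + i * (16 * r + 8)) r ∎
  where
  open import Relation.Binary.Reasoning.Setoid R.setoid
  exponent : ∀ i j r → 4 * r + (4 * i + 1) * (4 * (suc j + r) + 1) ≡
             16 * (i * j) + 12 * i + 4 * j + 5 + 8 * r + i * (16 * r + 8)
  exponent = ℕ-RingSolver.solve-∀

-- The common value of the two products.

pole : ℕ → ℕ → ℕ → ℤ⟦q⟧
pole i j s = frac (offset i j + 8 * s) s

monomial : ℕ → ℕ → ℕ → ℕ → ℤ⟦q⟧
monomial i j m k = q^ (4 * s + (4 * m + 3) * (4 * j + 3) + k * (16 * s + 8))
  where s = i ∸ suc m

-- In XB the fractions with s < i come from the negative terms and those with s ≤ j from
-- `frac-series-hasSum`; in AX it is the reverse.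
product-entry : ℕ → ℕ → ℤ⟦q⟧
product-entry i j = Σ∞ (pole i j) ⊖ (⨁ i (λ m → ⨁ (suc j) (monomial i j m)) ⊕ ⨁ i (pole i j) ⊕ ⨁ (suc j) (pole i j))

-- The distance s falls as the summation index rises, so the fractions appear in reverse order.
⨁-⊖-⊕ : ∀ K F G → ⨁ K (λ m → ⊖ (F m ⊕ G (K ∸ suc m))) ≈ ⊖ (⨁ K F ⊕ ⨁ K G)
⨁-⊖-⊕ K F G = R.trans (⨁-⊖ K (λ m → F m ⊕ G (K ∸ suc m))) (R.-‿cong
  (R.trans (⨁-⊕ K F (λ m → G (K ∸ suc m))) (R.+-congˡ {⨁ K F} (⨁-reverse K G))))

XB-column-suc : ∀ i j → (λ m → X i m ⊛ B m (suc j)) HasSum product-entry i j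
XB-column-suc i j = hasSum-cong (λ m → R.refl) total
  -- Term 0 vanishes because `B 0 (suc j)` is `𝟎`; the next `i` terms lie on or below the diagonal
  -- of `X`, the rest above it.
  (hasSum-prefix 1 (hasSum-prefix i
    (hasSum-cong (λ r → R.sym (XB-right i j r)) R.refl (frac-series-hasSum (offset i j) (suc j)))))
  where
  left : ∀ m → m < i → X i (suc m) ⊛ B (suc m) (suc j) ≈ ⊖ (⨁ (suc j) (monomial i j m) ⊕ pole i j (i ∸ suc m))
  left m m<i = subst
    (λ i′ → X i′ (suc m) ⊛ B (suc m) (suc j) ≈
      ⊖ (⨁ (suc j) (monomial i j m) ⊕ frac (offset i′ j + 8 * (i ∸ suc m)) (i ∸ suc m)))
    (ℕₚ.m+[n∸m]≡n m<i) (XB-left j (i ∸ suc m) m)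
  total : ⨁ 1 (λ m → X i m ⊛ B m (suc j)) ⊕ (⨁ i (λ m → X i (suc m) ⊛ B (suc m) (suc j)) ⊕
          (Σ∞ (pole i j) ⊖ ⨁ (suc j) (pole i j))) ≈ product-entry i j
  total = R.trans
    (R.+-cong (R.trans (R.+-identityʳ (X i 0 ⊛ 𝟎)) (R.zeroʳ (X i 0)))
      (R.+-congʳ {Σ∞ (pole i j) ⊖ ⨁ (suc j) (pole i j)}
        (R.trans (⨁-cong-< i left) (⨁-⊖-⊕ i (λ m → ⨁ (suc j) (monomial i j m)) (pole i j)))))
    (R.trans (R.+-identityˡ _)
      (solve 4 (λ d a b w → :- (d :+ a) :+ (w :- b) := w :- (d :+ a :+ b)) refl
        (⨁ i (λ m → ⨁ (suc j) (monomial i j m))) (⨁ i (pole i j)) (⨁ (suc j) (pole i j)) (Σ∞ (pole i j))))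

AX-column-suc : ∀ i j → (λ m → A i m ⊛ X m (suc j)) HasSum product-entry i j
AX-column-suc i j = hasSum-cong (λ m → R.refl) total
  (hasSum-prefix (suc j)
    (hasSum-cong (λ r → R.sym (AX-right i j r)) R.refl (frac-series-hasSum (offset i j) i)))
  where
  monomial′ : ℕ → ℕ → ℤ⟦q⟧
  monomial′ m k = q^ (12 * s + 4 + (4 * i + 1) * (4 * m + 1) + k * (16 * s + 8))
    where s = j ∸ m
  -- `j ∸ m` is `suc j ∸ suc m` by definition, the form reversed by `⨁-⊖-⊕`.
  left : ∀ m → m < suc j → A i m ⊛ X m (suc j) ≈ ⊖ (⨁ i (monomial′ m) ⊕ pole i j (j ∸ m))
  left m (s≤s m≤j) = subst
    (λ j′ → A i m ⊛ X m (suc j′) ≈ ⊖ (⨁ i (monomial′ m) ⊕ frac (offset i j′ + 8 * (j ∸ m)) (j ∸ m)))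
    (ℕₚ.m+[n∸m]≡n m≤j) (AX-left i m (j ∸ m))
  -- The double sums agree termwise with indices exchanged: putting i = k + 1 + s₁ and j = m + s₂
  -- makes the exponents equal polynomials.
  monomial′≈monomial : ∀ m → m < suc j → ∀ k → k < i → monomial′ m k ≈ monomial i j k m
  monomial′≈monomial m (s≤s m≤j) k k<i = q^-cong (subst₂
    (λ i′ j′ → 12 * s₂ + 4 + (4 * i′ + 1) * (4 * m + 1) + k * (16 * s₂ + 8) ≡
               4 * s₁ + (4 * k + 3) * (4 * j′ + 3) + m * (16 * s₁ + 8))
    (ℕₚ.m+[n∸m]≡n k<i) (ℕₚ.m+[n∸m]≡n m≤j) (exponent k m s₁ s₂))
    where
    s₁ = i ∸ suc k
    s₂ = j ∸ m
    exponent : ∀ k m s₁ s₂ → 12 * s₂ + 4 + (4 * (suc k + s₁) + 1) * (4 * m + 1) + k * (16 * s₂ + 8) ≡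
               4 * s₁ + (4 * k + 3) * (4 * (m + s₂) + 3) + m * (16 * s₁ + 8)
    exponent = ℕ-RingSolver.solve-∀
  total : ⨁ (suc j) (λ m → A i m ⊛ X m (suc j)) ⊕ (Σ∞ (pole i j) ⊖ ⨁ i (pole i j)) ≈ product-entry i j
  total = R.trans
    (R.+-congʳ {Σ∞ (pole i j) ⊖ ⨁ i (pole i j)} (R.trans (⨁-cong-< (suc j) left)
      (R.trans (⨁-⊖-⊕ (suc j) (λ m → ⨁ i (monomial′ m)) (pole i j))
        (R.-‿cong (R.+-congʳ {⨁ (suc j) (pole i j)} (R.trans
          (⨁-cong-< (suc j) (λ m m≤j → ⨁-cong-< i (monomial′≈monomial m m≤j)))
          (⨁-swap (suc j) i (λ m k → monomial i j k m))))))))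
    (solve 4 (λ d a b w → :- (d :+ b) :+ (w :- a) := w :- (d :+ a :+ b)) refl
      (⨁ i (λ m → ⨁ (suc j) (monomial i j m))) (⨁ i (pole i j)) (⨁ (suc j) (pole i j)) (Σ∞ (pole i j)))

mainTheorem2 : ∃ λ (P : Matrix) → (X · B ⇒ P) × (A · X ⇒ P)
mainTheorem2 = P
  , (λ { i zero → sumsTo (XB-column₀ i) ; i (suc j) → sumsTo (XB-column-suc i j) })
  , (λ { i zero → sumsTo (AX-column₀ i) ; i (suc j) → sumsTo (AX-column-suc i j) })
  where
  P : Matrix
  P i zero    = X i 0 ⊛ B 0 0
  P i (suc j) = product-entry i j
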